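{- For every FOLDS vocabulary $K$, the pre-signature $\Sigma_K$ is a signature.
   Context: Type system. Let $V$ be an infinite set of variables with decidable equality and the unrestricted fresh variable provider ($\varphi(X)=V\setminus X$ for finite $X\subseteq V$, with $\mathsf{fr}(X)\in\varphi(X)$ some choice). Preelements are terms built from variables and function symbols; a pretype is $S(t_1,\ldots,t_n)$ with $S$ a type symbol and $t_i$ preelements; $\mathrm{V}(E)$ denotes the variables of $E$ and $E[\bar a/\bar x]$ simultaneous substitution. A precontext is $\Gamma=x_1:A_1,\ldots,x_n:A_n$ with distinct variables and $\mathrm{V}(A_k)\subseteq\{x_1,\ldots,x_{k-1}\}$; $\mathrm{OV}(\Gamma)=x_1,\ldots,x_n$. A type declaration on standard form is a pair $(\Gamma,S)$ with $\Gamma$ a precontext and $S$ a type symbol. For a set $\Sigma$ of such declarations (each symbol declared once), $\mathcal{J}(\Sigma)$ is the smallest set of judgements closed under: (R1) $\langle\rangle$ context; (R2) from $\Gamma$ context and $A$ type $(\Gamma)$ infer $\Gamma,x:A$ context for $x\notin\mathrm{V}(\Gamma)$; (R3) from $x_1:A_1,\ldots,x_n:A_n$ context infer $x_i:A_i\ (x_1:A_1,\ldots,x_n:A_n)$; (R4) if $(\Gamma,S)\in\Sigma$ with $\Gamma=x_1:A_1,\ldots,x_n:A_n$ and $\bar a:\Delta\to\Gamma$, infer $S(a_1,\ldots,a_n)$ type $(\Delta)$; where $\bar a:\Delta\to\Gamma$ abbreviates the judgements $\Delta$ context, $\Gamma$ context, $a_k:A_k[a_1,\ldots,a_{k-1}/x_1,\ldots,x_{k-1}]\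 (\Delta)$ ($k=1,\ldots,n$). $\Sigma$ is a signature if ($\Gamma$ context)$\in\mathcal{J}(\Sigma)$ for every $(\Gamma,S)\in\Sigma$. FOLDS vocabulary: a finite skeletal category $K$ with no non-identity endomorphisms. Write $A\le B$ iff there is a morphism $B\to A$; this is a well-founded partial order on objects; fix a linear order $\le^*$ extending it. For each object $A$ fix a non-repeating enumeration $x^A_1,\ldots,x^A_{n(A)}$ of all non-identity morphisms with domain $A$ such that $\mathrm{cod}(x^A_i)\le^*\mathrm{cod}(x^A_j)$ whenever $i<j$. The objects of $K$ serve as type symbols and the morphisms of $K$ as variables ($K\subseteq V$). For a sequence $\bar u=u_1,\ldots,u_m$ of morphisms with domain $\mathrm{cod}(v)$ write $\bar u^v=u_1v,\ldots,u_mv$ (composites). By induction on $\le$ define for each object $A$ the precontext $\Gamma_A=x_1:A_1,\ldots,x_n:A_n$ where $n=n(A)$, $x_i=x^A_i$, $C_i=\mathrm{cod}(x_i)$, and $A_i=C_i(\mathrm{OV}(\Gamma_{C_i})^{x_i})$. Then $\Sigma_K=\{(\Gamma_A,A): A \text{ an object of } K\}$. -}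

module Defs where

open import Level using (Level; _⊔_; suc)
open import Data.Fin.Base using (Fin; toℕ) renaming (suc to fsuc; zero to fzero)
open import Data.Bool.Base using (if_then_else_)
open import Data.List.Base using (List; []; _∷_; _++_; _∷ʳ_; map; concatMap; take; length; lookup)
open import Data.List.Properties using (map-∘)
open import Data.List.Membership.Propositional using (_∈_; _∉_)
open import Data.List.Membership.Propositional.Properties using (∈-++⁻; ∈-map⁻; ∈-map⁺)
open import Data.List.Relation.Unary.All as All using (All)
open import Data.List.Relation.Unary.Any using (here; there)
open import Data.List.Relation.Unary.AllPairs using (AllPairs; _∷_)
open import Data.List.Relation.Unary.Unique.Propositional using (Unique)
open import Data.List.Relation.Unary.Unique.Propositional.Properties using (map⁺)
open import Data.List.Relation.Binary.Subset.Propositional using (_⊆_)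
open import Data.Vec.Base as Vec using (Vec)
open import Data.Product.Base using (∃; _×_; _,_; proj₁; proj₂)
open import Data.Sum.Base using (inj₁; inj₂)
open import Function.Base using (_∘_)
open import Function.Bundles using (_↔_; _↣_; _⇔_; module Injection; module Equivalence)
open import Relation.Binary.Core using (Rel)
open import Relation.Binary.Definitions using (DecidableEquality)
open import Relation.Binary.Structures using (IsTotalOrder)
open import Relation.Binary.PropositionalEquality
  using (_≡_; _≢_; refl; sym; trans; cong; subst; subst₂)
open import Relation.Nullary.Decidable.Core using (does)
open import Relation.Nullary.Negation.Core using (¬_; contradiction)

-- Infinity of the set of variables is expressed by the choice function fr for
-- the unrestricted fresh variable provider φ.
record VariableSet (v : Level) : Set (suc v) where
  infix 4 _≟_
  field
    Var : Set v
    _≟_ : DecidableEquality Var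

  φ : List Var → Var → Set v
  φ X x = x ∉ X

  field
    fr   : List Var → Var
    fr∈φ : ∀ X → φ X (fr X)

-- F and T are the sets of function symbols and of type symbols.
module Syntax {v f t} (𝕍 : VariableSet v) (F : Set f) (T : Set t) where
  open VariableSet 𝕍

  data Preelement : Set (v ⊔ f) where
    var : Var → Preelement
    fun : F → List Preelement → Preelement

  data Pretype : Set (v ⊔ f ⊔ t) where
    typ : T → List Preelement → Pretype

  mutual
    Vᵉ : Preelement → List Var
    Vᵉ (var x)    = x ∷ []
    Vᵉ (fun g as) = Vᵉ* as

    Vᵉ* : List Preelement → List Var
    Vᵉ* []       = []
    Vᵉ* (a ∷ as) = Vᵉ a ++ Vᵉ* as

  Vᵗ : Pretype → List Var
  Vᵗ (typ S as) = Vᵉ* as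

  subVar : List Preelement → List Var → Var → Preelement
  subVar (a ∷ as) (x ∷ xs) y = if does (y ≟ x) then a else subVar as xs y
  subVar _        _        y = var y

  mutual
    _[_/_]ᵉ : Preelement → List Preelement → List Var → Preelement
    var y    [ as / xs ]ᵉ = subVar as xs y
    fun g bs [ as / xs ]ᵉ = fun g (bs [ as / xs ]ᵉ*)

    _[_/_]ᵉ* : List Preelement → List Preelement → List Var → List Preelement
    []       [ as / xs ]ᵉ* = []
    (b ∷ bs) [ as / xs ]ᵉ* = b [ as / xs ]ᵉ ∷ bs [ as / xs ]ᵉ*

  _[_/_]ᵗ : Pretype → List Preelement → List Var → Pretype
  typ S bs [ as / xs ]ᵗ = typ S (bs [ as / xs ]ᵉ*)

  -- x₁ : A₁ , … , xₙ : Aₙ, listed from left to right.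
  Declarations : Set (v ⊔ f ⊔ t)
  Declarations = List (Var × Pretype)

  OV : Declarations → List Var
  OV = map proj₁

  Vᶜ : Declarations → List Var
  Vᶜ = concatMap λ (x , A) → x ∷ Vᵗ A

  record IsPrecontext (Γ : Declarations) : Set (v ⊔ f ⊔ t) where
    field
      distinct : Unique (OV Γ)
      scoped   : ∀ (k : Fin (length Γ)) →
                 Vᵗ (proj₂ (lookup Γ k)) ⊆ OV (take (toℕ k) Γ)

  record Precontext : Set (v ⊔ f ⊔ t) where
    constructor _,ₚ_
    field
      decls        : Declarations
      isPrecontext : IsPrecontext decls
  open Precontext public

  TypeDeclaration : Set (v ⊔ f ⊔ t)
  TypeDeclaration = Precontext × T

  record PreSignature (ℓ : Level) : Set (v ⊔ f ⊔ t ⊔ suc ℓ) where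
    field
      Declares     : TypeDeclaration → Set ℓ
      declaredOnce : ∀ {Γ Γ′ S} → Declares (Γ , S) → Declares (Γ′ , S) →
                     decls Γ ≡ decls Γ′

  -- Judgements mention lists of declarations that need not be precontexts, but
  -- R2 can only extend a list by a fresh variable and by a type whose
  -- variables are declared in it, so only judgements over precontexts are
  -- derivable.
  data Judgement : Set (v ⊔ f ⊔ t) where
    _context : Declarations → Judgement
    _type⟨_⟩ : Pretype → Declarations → Judgement
    _∶_⟨_⟩   : Preelement → Pretype → Declarations → Judgement

  -- The judgements abbreviated by ā : Δ → Γ, required to be in the set 𝒥.
  record ContextMap {ℓ} (𝒥 : Judgement → Set ℓ) (Δ Γ : Declarations)
                    (as : Vec Preelement (length Γ)) : Set (v ⊔ f ⊔ t ⊔ ℓ) where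
    inductive
    constructor contextMap
    field
      source   : 𝒥 (Δ context)
      target   : 𝒥 (Γ context)
      elements : ∀ (k : Fin (length Γ)) →
        𝒥 (Vec.lookup as k ∶
             proj₂ (lookup Γ k)
               [ take (toℕ k) (Vec.toList as) / OV (take (toℕ k) Γ) ]ᵗ
             ⟨ Δ ⟩)

  data 𝒥 {ℓ} (Sig : PreSignature ℓ) : Judgement → Set (v ⊔ f ⊔ t ⊔ ℓ) where
    R1 : 𝒥 Sig ([] context)
    R2 : ∀ {Γ A x} → 𝒥 Sig (Γ context) → 𝒥 Sig (A type⟨ Γ ⟩) → φ (Vᶜ Γ) x →
         𝒥 Sig ((Γ ∷ʳ (x , A)) context)
    R3 : ∀ {Γ x A} → 𝒥 Sig (Γ context) → (x , A) ∈ Γ →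
         𝒥 Sig (var x ∶ A ⟨ Γ ⟩)
    R4 : ∀ {Γ S Δ as} → PreSignature.Declares Sig (Γ , S) →
         ContextMap (𝒥 Sig) Δ (decls Γ) as →
         𝒥 Sig (typ S (Vec.toList as) type⟨ Δ ⟩)

  IsSignature : ∀ {ℓ} → PreSignature ℓ → Set (v ⊔ f ⊔ t ⊔ ℓ)
  IsSignature Sig = ∀ {Γ S} → PreSignature.Declares Sig (Γ , S) →
                    𝒥 Sig (decls Γ context)

Finite : ∀ {a} → Set a → Set a
Finite X = ∃ λ n → X ↔ Fin n

record FOLDSVocabulary (o h : Level) : Set (suc (o ⊔ h)) where
  infixr 9 _∙_
  field
    Obj : Set o
    Hom : Obj → Obj → Set h
    id  : ∀ {A} → Hom A A
    -- Composition in the usual order: u ∙ v is v followed by u.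
    _∙_ : ∀ {A B C} → Hom B C → Hom A B → Hom A C
    identityˡ : ∀ {A B} (u : Hom A B) → id ∙ u ≡ u
    identityʳ : ∀ {A B} (u : Hom A B) → u ∙ id ≡ u
    assoc     : ∀ {A B C D} (u : Hom C D) (v : Hom B C) (w : Hom A B) →
                (u ∙ v) ∙ w ≡ u ∙ (v ∙ w)
    finiteObj : Finite Obj
    finiteHom : ∀ A B → Finite (Hom A B)
    skeletal  : ∀ {A B} (u : Hom A B) (v : Hom B A) →
                v ∙ u ≡ id → u ∙ v ≡ id → A ≡ B
    noEndo    : ∀ {A} (u : Hom A A) → u ≡ id

  _≤_ : Rel Obj h
  A ≤ B = Hom B A

  Out : Obj → Set (o ⊔ h)
  Out A = ∃ λ B → Hom A B

  cod : ∀ {A} → Out A → Obj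
  cod = proj₁

  NonIdentity : ∀ {A} → Out A → Set (o ⊔ h)
  NonIdentity {A} x = x ≢ (A , id)

  Arrow : Set (o ⊔ h)
  Arrow = ∃ λ A → Out A

  _^_ : ∀ {A C} → List (Out C) → Hom A C → List (Out A)
  us ^ v = map (λ (D , u) → D , u ∙ v) us

-- The choices fixed for a vocabulary: a linear order and, for each object A,
-- the enumeration of the non-identity morphisms with domain A.
record Enumeration {o h} (K : FOLDSVocabulary o h) (r : Level) : Set (o ⊔ h ⊔ suc r) where
  open FOLDSVocabulary K
  field
    _≤*_         : Rel Obj r
    isTotalOrder : IsTotalOrder _≡_ _≤*_
    extends      : ∀ {A B} → A ≤ B → A ≤* B
    xs           : ∀ A → List (Out A)
    nonRepeating : ∀ A → Unique (xs A)
    enumerates   : ∀ {A} (x : Out A) → x ∈ xs A ⇔ NonIdentity x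
    sorted       : ∀ A → AllPairs (λ x y → cod x ≤* cod y) (xs A)

prefixwise : ∀ {a b p} {X : Set a} {Y : Set b} (g : X → Y) (P : List Y → Y → Set p) →
  ∀ zs → (∀ ps z qs → zs ≡ ps ++ z ∷ qs → P (map g ps) (g z)) →
  ∀ k → P (take (toℕ k) (map g zs)) (lookup (map g zs) k)
prefixwise g P (z ∷ zs) hyp fzero    = hyp [] z zs refl
prefixwise g P (z ∷ zs) hyp (fsuc k) =
  prefixwise g (P ∘ (g z ∷_)) zs
    (λ ps y qs e → hyp (z ∷ ps) y qs (cong (z ∷_) e)) k

later : ∀ {a r} {X : Set a} {R : Rel X r} ps {z qs y} →
        AllPairs R (ps ++ z ∷ qs) → y ∈ qs → R z y
later []       (all ∷ _) y∈ = All.lookup all y∈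
later (_ ∷ ps) (_ ∷ aps) y∈ = later ps aps y∈

-- The inclusion K ⊆ V is given by an injection ι of the morphisms of K into
-- the set of variables.
module FOLDS {o h r v f} (K : FOLDSVocabulary o h) (E : Enumeration K r)
             (𝕍 : VariableSet v) (F : Set f)
             (ι : FOLDSVocabulary.Arrow K ↣ VariableSet.Var 𝕍) where
  open FOLDSVocabulary K
  open Enumeration E
  open Syntax 𝕍 F Obj

  variable′ : ∀ {A} → Out A → VariableSet.Var 𝕍
  variable′ {A} x = Injection.to ι (A , x)

  -- The pretype C(OV(Γ_C)^x) of the variable x : A → C; by OV-Γ-decls below,
  -- the morphisms in OV(Γ_C) are those in the list xs C.
  pretype : ∀ {A} → Out A → Pretype
  pretype (C , x) = typ C (map (var ∘ variable′) (xs C ^ x))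

  declare : ∀ {A} → Out A → VariableSet.Var 𝕍 × Pretype
  declare x = variable′ x , pretype x

  Γ-decls : Obj → Declarations
  Γ-decls A = map declare (xs A)

  OV-Γ-decls : ∀ A → OV (Γ-decls A) ≡ map variable′ (xs A)
  OV-Γ-decls A = sym (map-∘ (xs A))

  variable′-injective : ∀ {A} {x y : Out A} → variable′ x ≡ variable′ y → x ≡ y
  variable′-injective e with refl ← Injection.injective ι e = refl

  endo-identity : ∀ {A B} (u : Hom A B) → A ≡ B → ¬ NonIdentity (B , u)
  endo-identity u refl nonId = nonId (cong (_ ,_) (noEndo u))

  ∙-nonIdentity : ∀ {A C D} (u : Hom C D) (x : Hom A C) →
                  NonIdentity (C , x) → NonIdentity (D , u ∙ x)
  ∙-nonIdentity u x nonId e = endo-identity x (cycle (cong cod e) x u) nonId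
    where
    cycle : ∀ {A C D} → D ≡ A → Hom A C → Hom C D → A ≡ C
    cycle refl x u = skeletal x u (noEndo _) (noEndo _)

  -- The composites u ∙ x with u in xs C precede x : A → C in xs A.
  composite-earlier : ∀ {A C D} {x : Hom A C} {u : Hom C D} ps qs →
    xs A ≡ ps ++ (C , x) ∷ qs → (D , u) ∈ xs C → (D , u ∙ x) ∈ ps
  composite-earlier {A} {C} {D} {x} {u} ps qs e u∈
    with ∈-++⁻ ps (subst ((D , u ∙ x) ∈_) e
           (Equivalence.from (enumerates _) (∙-nonIdentity u x x-nonId)))
    where
    mid : ∀ ps → (C , x) ∈ ps ++ (C , x) ∷ qs
    mid []       = here refl
    mid (_ ∷ ps) = there (mid ps)

    x-nonId : NonIdentity (C , x)
    x-nonId = Equivalence.to (enumerates _) (subst ((C , x) ∈_) (sym e) (mid ps))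
  ... | inj₁ ux∈        = ux∈
  ... | inj₂ (here ux≡) =
    contradiction (Equivalence.to (enumerates _) u∈)
      (endo-identity u (sym (cong cod ux≡)))
  ... | inj₂ (there ux∈) =
    contradiction (Equivalence.to (enumerates _) u∈)
      (endo-identity u (IsTotalOrder.antisym isTotalOrder
        (later ps (subst (AllPairs _) e (sorted A)) ux∈) (extends u)))

  ∈-Vᵉ*-var : ∀ {y} zs → y ∈ Vᵉ* (map var zs) → y ∈ zs
  ∈-Vᵉ*-var (z ∷ zs) (here p)  = here p
  ∈-Vᵉ*-var (z ∷ zs) (there p) = there (∈-Vᵉ*-var zs p)

  pretype-scoped : ∀ {A} ps (x : Out A) qs → xs A ≡ ps ++ x ∷ qs →
                   Vᵗ (pretype x) ⊆ OV (map declare ps)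
  pretype-scoped {A} ps (C , x) qs e {y} y∈
    with w , w∈ , y≡ ← ∈-map⁻ (variable′ {A})
           (∈-Vᵉ*-var _ (subst ((y ∈_) ∘ Vᵉ*) (map-∘ (xs C ^ x)) y∈))
    with (D , u) , u∈ , w≡ ← ∈-map⁻ (λ ((D , u) : Out C) → D , u ∙ x) w∈
    = subst₂ _∈_ (sym y≡) (map-∘ ps)
        (∈-map⁺ variable′ (subst (_∈ ps) (sym w≡) (composite-earlier ps qs e u∈)))

  Γ-isPrecontext : ∀ A → IsPrecontext (Γ-decls A)
  Γ-isPrecontext A = record
    { distinct = subst Unique (sym (OV-Γ-decls A))
                   (map⁺ variable′-injective (nonRepeating A))
    ; scoped   = prefixwise declare (λ Δ (_ , B) → Vᵗ B ⊆ OV Δ) (xs A) pretype-scoped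
    }

  Γ[_] : Obj → Precontext
  Γ[ A ] = Γ-decls A ,ₚ Γ-isPrecontext A

  Σ-K : PreSignature (o ⊔ v ⊔ f)
  Σ-K = record
    { Declares     = λ d → ∃ λ A → d ≡ (Γ[ A ] , A)
    ; declaredOnce = λ { (_ , refl) (_ , refl) → refl }
    }

{-# OPTIONS --safe #-}

-- For a non-identity x : A → C, the type of the variable x is well formed
-- because u ↦ u ∙ x is a context map to Γ_C from the part of Γ_A preceding x:
-- each composite u ∙ x is declared before x, and substituting v ∙ x for each v
-- in the type of u gives the type of u ∙ x, by associativity. Γ_C is a context
-- by well-founded induction, C being strictly below A in the finite order ≤.
module Submission where

open import Defs
open import Level using (_⊔_)
open import Data.Fin.Base using (toℕ) renaming (suc to fsuc; zero to fzero)
open import Data.Fin.Induction using (spo-wellFounded)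
open import Data.List.Base using (List; []; _∷_; _++_; _∷ʳ_; map; take; length; lookup)
open import Data.List.Properties using (map-∘; map-cong; map-++; ∷ʳ-++; ++-assoc; ++-identityʳ)
open import Data.List.Membership.Propositional using (_∈_; _∉_; find)
open import Data.List.Membership.Propositional.Properties
  using (∈-++⁺ˡ; ∈-++⁺ʳ; ∈-concatMap⁻; ∈-map⁻; ∈-map⁺; ∈-∃++)
open import Data.List.Relation.Unary.All as All using ()
open import Data.List.Relation.Unary.AllPairs using (_∷_)
open import Data.List.Relation.Unary.Any using (here; there)
open import Data.List.Relation.Unary.Unique.Propositional using (Unique)
open import Data.List.Relation.Binary.Subset.Propositional using (_⊆_)
open import Data.Vec.Base as Vec using (Vec; []; _∷_)
open import Data.Product.Base using (∃; _,_; proj₁; proj₂)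
open import Function.Base using (_∘_)
open import Function.Bundles using (_↣_; module Equivalence; module Inverse)
open import Induction.WellFounded using (WellFounded; Acc; acc; module Subrelation)
open import Relation.Binary.Construct.On as On using ()
open import Relation.Binary.Core using (Rel)
open import Relation.Binary.Structures using (IsStrictPartialOrder)
open import Relation.Binary.PropositionalEquality
  using (_≡_; refl; sym; trans; cong; cong₂; subst; subst₂; isEquivalence; module ≡-Reasoning)
open import Relation.Nullary.Decidable.Core using (yes; no)
open import Relation.Nullary.Negation.Core using (contradiction)

unique-∉ : ∀ {a} {X : Set a} (ps : List X) {x qs} → Unique (ps ++ x ∷ qs) → x ∉ ps
unique-∉ (p ∷ ps) (p≢ ∷ _) (here refl) = All.lookup p≢ (∈-++⁺ʳ ps (here refl)) refl
unique-∉ (p ∷ ps) (_ ∷ uniq) (there x∈) = unique-∉ ps uniq x∈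

module _ {a b c} {X : Set a} {Y : Set b} {Z : Set c} (g : X → Y) (h : X → Z) where

  -- The length is written as that of `map g zs` because a context map into `map g zs` takes a
  -- vector indexed by exactly this length.
  mapVec : ∀ zs → Vec Z (length (map g zs))
  mapVec []       = []
  mapVec (z ∷ zs) = h z ∷ mapVec zs

  toList-mapVec : ∀ zs → Vec.toList (mapVec zs) ≡ map h zs
  toList-mapVec []       = refl
  toList-mapVec (z ∷ zs) = cong (h z ∷_) (toList-mapVec zs)

  -- Serves to pass from the position-indexed `elements` of a context map to splittings
  -- `ps ++ z ∷ qs`. In the recursion the predicate absorbs the head of both mapped lists.
  prefixwise₂ : ∀ {p} (P : List Z → Z → List Y → Y → Set p) zs →
    (∀ ps z qs → zs ≡ ps ++ z ∷ qs → P (map h ps) (h z) (map g ps) (g z)) →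
    ∀ k → P (take (toℕ k) (Vec.toList (mapVec zs))) (Vec.lookup (mapVec zs) k)
            (take (toℕ k) (map g zs)) (lookup (map g zs) k)
  prefixwise₂ P (z ∷ zs) hyp fzero    = hyp [] z zs refl
  prefixwise₂ P (z ∷ zs) hyp (fsuc k) =
    prefixwise₂ (λ cs c bs b → P (h z ∷ cs) c (g z ∷ bs) b) zs
      (λ ps y qs e → hyp (z ∷ ps) y qs (cong (z ∷_) e)) k

module _ {v f t} (𝕍 : VariableSet v) (F : Set f) (T : Set t) where
  open VariableSet 𝕍
  open Syntax 𝕍 F T

  -- `subVar` takes the first match, and injectivity of `g` forces any match to be `z` itself, so
  -- repetitions in `zs` do no harm.
  subVar-map : ∀ {x} {X : Set x} (g : X → Var) (h : X → Preelement) →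
    (∀ {y z} → g y ≡ g z → y ≡ z) →
    ∀ {z} zs → z ∈ zs → subVar (map h zs) (map g zs) (g z) ≡ h z
  subVar-map g h inj {z} (y ∷ zs) z∈ with g z ≟ g y | z∈
  ... | yes gz≡gy | _         = cong h (sym (inj gz≡gy))
  ... | no  gz≢gy | here z≡y  = contradiction (cong g z≡y) gz≢gy
  ... | no  _     | there z∈′ = subVar-map g h inj zs z∈′

  map-var-sub : ∀ {x} {X : Set x} (g : X → Var) (h : X → Preelement) →
    (∀ {y z} → g y ≡ g z → y ≡ z) →
    ∀ {ps} zs → zs ⊆ ps → map (var ∘ g) zs [ map h ps / map g ps ]ᵉ* ≡ map h zs
  map-var-sub g h inj []       zs⊆ps = refl
  map-var-sub g h inj (z ∷ zs) zs⊆ps =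
    cong₂ _∷_ (subVar-map g h inj _ (zs⊆ps (here refl)))
              (map-var-sub g h inj zs (zs⊆ps ∘ there))

module _ {o h r v f} (K : FOLDSVocabulary o h) (E : Enumeration K r)
         (𝕍 : VariableSet v) (F : Set f)
         (ι : FOLDSVocabulary.Arrow K ↣ VariableSet.Var 𝕍) where
  open FOLDSVocabulary K
  open Enumeration E
  open VariableSet 𝕍
  open Syntax 𝕍 F Obj
  open FOLDS K E 𝕍 F ι

  -- Freshness in R2 also concerns variables inside types. Splitting `ps` around `z`,
  -- `pretype-scoped` shows that the type of `z` mentions only variables declared before `z`.
  Vᶜ⊆OV : ∀ {A} ps qs → xs A ≡ ps ++ qs → Vᶜ (map declare ps) ⊆ OV (map declare ps)
  Vᶜ⊆OV ps qs e y∈ with find (∈-concatMap⁻ (λ (x , B) → x ∷ Vᵗ B) {map declare ps} y∈)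
  ... | _ , d∈ , here refl = ∈-map⁺ proj₁ d∈
  ... | _ , d∈ , there y∈B
    with z , z∈ , refl ← ∈-map⁻ declare d∈
    with ps₁ , ps₂ , refl ← ∈-∃++ z∈
    = subst (λ Δ → _ ∈ OV Δ) (sym (map-++ declare ps₁ (z ∷ ps₂)))
        (subst (_ ∈_) (sym (map-++ proj₁ (map declare ps₁) _))
          (∈-++⁺ˡ (pretype-scoped ps₁ z (ps₂ ++ qs)
            (trans e (++-assoc ps₁ (z ∷ ps₂) qs)) y∈B)))

  variable′-fresh : ∀ {A} ps x qs → xs A ≡ ps ++ x ∷ qs →
                    φ (Vᶜ (map declare ps)) (variable′ x)
  variable′-fresh {A} ps x qs e x∈
    with z , z∈ , vx≡vz ← ∈-map⁻ variable′
           (subst (_ ∈_) (sym (map-∘ ps)) (Vᶜ⊆OV ps (x ∷ qs) e x∈))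
    = unique-∉ ps (subst Unique e (nonRepeating A))
        (subst (_∈ ps) (sym (variable′-injective vx≡vz)) z∈)

  image : ∀ {A C} → Hom A C → Out C → Preelement
  image x (D , u) = var (variable′ (D , u ∙ x))

  pretype-sub : ∀ {A C D} (x : Hom A C) (u : Hom C D) ps qs → xs C ≡ ps ++ (D , u) ∷ qs →
    pretype (D , u) [ map (image x) ps / OV (map declare ps) ]ᵗ ≡ pretype (D , u ∙ x)
  pretype-sub {C = C} {D} x u ps qs e = cong (typ D) (begin
    map (var ∘ variable′) (xs D ^ u) [ map (image x) ps / OV (map declare ps) ]ᵉ*
      ≡⟨ cong (map (var ∘ variable′) (xs D ^ u) [ map (image x) ps /_]ᵉ*) (map-∘ ps) ⟨
    map (var ∘ variable′) (xs D ^ u) [ map (image x) ps / map variable′ ps ]ᵉ*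
      -- Every composite `w ∙ u` precedes `u` in `xs C`, so each variable is really replaced and the
      -- default `var y` of `subVar` is never reached.
      ≡⟨ map-var-sub 𝕍 F Obj variable′ (image x) variable′-injective (xs D ^ u) composites⊆ps ⟩
    map (image x) (xs D ^ u)
      ≡⟨ map-∘ (xs D) ⟨
    map (λ (B , w) → var (variable′ (B , (w ∙ u) ∙ x))) (xs D)
      ≡⟨ map-cong (λ (B , w) → cong (λ y → var (variable′ (B , y))) (assoc w u x)) (xs D) ⟩
    map (λ (B , w) → var (variable′ (B , w ∙ (u ∙ x)))) (xs D)
      ≡⟨ map-∘ (xs D) ⟩
    map (var ∘ variable′) (xs D ^ (u ∙ x)) ∎)
    where
    open ≡-Reasoning

    composites⊆ps : (xs D ^ u) ⊆ ps
    composites⊆ps z∈ with _ , w∈ , refl ← ∈-map⁻ _ z∈ = composite-earlier ps qs e w∈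

  pretype-derivable : ∀ {A C} (x : Hom A C) ps qs → xs A ≡ ps ++ (C , x) ∷ qs →
    𝒥 Σ-K (Γ-decls C context) → 𝒥 Σ-K (map declare ps context) →
    𝒥 Σ-K (pretype (C , x) type⟨ map declare ps ⟩)
  pretype-derivable {A} {C} x ps qs e Γ-C Δ =
    -- R4 yields the arguments as the list of a vector of images; this transport puts them in the
    -- form used by `pretype`.
    subst (λ as → 𝒥 Σ-K (typ C as type⟨ map declare ps ⟩))
      (trans (toList-mapVec declare (image x) (xs C)) (map-∘ (xs C)))
      (R4 (C , refl) (contextMap Δ Γ-C
        (prefixwise₂ declare (image x)
          (λ as a Γ (_ , B) → 𝒥 Σ-K (a ∶ B [ as / OV Γ ]ᵗ ⟨ map declare ps ⟩))
          (xs C) element)))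
    where
    element : ∀ ps′ z qs′ → xs C ≡ ps′ ++ z ∷ qs′ →
      𝒥 Σ-K (image x z ∶ pretype z [ map (image x) ps′ / OV (map declare ps′) ]ᵗ ⟨ map declare ps ⟩)
    element ps′ (D , u) qs′ e′ =
      subst (λ B → 𝒥 Σ-K (image x (D , u) ∶ B ⟨ map declare ps ⟩))
        (sym (pretype-sub x u ps′ qs′ e′))
        (R3 Δ (∈-map⁺ declare (composite-earlier ps qs e
          (subst (_ ∈_) (sym e′) (∈-++⁺ʳ ps′ (here refl))))))

  _⋖_ : Rel Obj (o ⊔ h)
  B ⋖ A = ∃ λ (u : Hom A B) → NonIdentity (B , u)

  -- The relation is pulled back from `Fin n` along the enumeration of the objects, since strict
  -- partial orders on `Fin n` are well founded. Irreflexivity comes from `noEndo`, transitivity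
  -- from `∙-nonIdentity`.
  ⋖-wellFounded : WellFounded _⋖_
  ⋖-wellFounded =
    Subrelation.wellFounded
      -- The pulled-back relation compares `from (to B)` with `from (to A)`, which equal `B` and `A`
      -- only propositionally.
      (λ {B} {A} → subst₂ _⋖_ (sym (strictlyInverseʳ B)) (sym (strictlyInverseʳ A)))
      (On.wellFounded to (spo-wellFounded isSPO))
    where
    open Inverse (proj₂ finiteObj)

    isSPO : IsStrictPartialOrder _≡_ (λ i j → from i ⋖ from j)
    isSPO = record
      { isEquivalence = isEquivalence
      ; irrefl        = λ { refl (u , nonId) → nonId (cong (_ ,_) (noEndo u)) }
      ; trans         = λ { (u , _) (x , nonId) → u ∙ x , ∙-nonIdentity u x nonId }
      ; <-resp-≈      = (λ { refl p → p }) , (λ { refl p → p })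
      }

  Γ-context : ∀ A → Acc _⋖_ A → 𝒥 Σ-K (Γ-decls A context)
  Γ-context A (acc rec) = extend [] (xs A) refl R1
    where
    -- Each use of R2 moves one entry from `qs` to the end of `ps`. This recursion is structural in
    -- `qs`; accessibility of `A` is spent only on the contexts of the codomains.
    extend : ∀ ps qs → xs A ≡ ps ++ qs → 𝒥 Σ-K (map declare ps context) →
             𝒥 Σ-K (Γ-decls A context)
    extend ps [] e Δ =
      subst (λ zs → 𝒥 Σ-K (map declare zs context)) (sym (trans e (++-identityʳ ps))) Δ
    extend ps ((C , x) ∷ qs) e Δ =
      extend (ps ∷ʳ (C , x)) qs (trans e (sym (∷ʳ-++ ps (C , x) qs)))
        (subst (λ Γ → 𝒥 Σ-K (Γ context)) (sym (map-++ declare ps _))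
          (R2 Δ (pretype-derivable x ps qs e (Γ-context C (rec (x , x-nonId))) Δ)
            (variable′-fresh ps (C , x) qs e)))
      where
      x-nonId : NonIdentity (C , x)
      x-nonId = Equivalence.to (enumerates (C , x))
        (subst ((C , x) ∈_) (sym e) (∈-++⁺ʳ ps (here refl)))

mainTheorem8 : ∀ {o h r v f}
    (K : FOLDSVocabulary o h) (E : Enumeration K r)
    (𝕍 : VariableSet v) (F : Set f)
    (ι : FOLDSVocabulary.Arrow K ↣ VariableSet.Var 𝕍) →
    Syntax.IsSignature 𝕍 F (FOLDSVocabulary.Obj K) (FOLDS.Σ-K K E 𝕍 F ι)
mainTheorem8 K E 𝕍 F ι (A , refl) =
  Γ-context K E 𝕍 F ι A (⋖-wellFounded K E 𝕍 F ι A)
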